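{- Let $f(x)\in\mathbf{Z}[x]$ be a polynomial of degree 1, and let $p$ be a good prime for $f(x)$. Then for every integer $m$ coprime to $p$ there exist infinitely many elements $d\in\mathcal{S}(f)$ such that $d\equiv m\pmod p$.
   Context: Squarefree integers may be negative and are nonzero. For a nonzero rational number $r$, its squarefree part $S(r)$ is the unique squarefree integer $d$ such that $r/d$ is a square in $\mathbf{Q}$. For a separable nonconstant $f(x)\in\mathbf{Z}[x]$, $\mathcal{S}(f)=\{S(f(r)) : r\in\mathbf{Q},\ f(r)\neq 0\}$. An odd prime $p$ is good for $f(x)$ if the reduced polynomial $\bar f(x)\in\mathbf{F}_p[x]$ has the same degree as $f(x)$ and has nonzero discriminant (a polynomial of degree 1 has discriminant 1). -}

module Defs where

open import Algebra.Bundles.Raw using (RawRing)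
import Algebra.Definitions.RawMonoid as RawMonoidDefs
import Algebra.Definitions.RawSemiring as RawSemiringDefs
open import Data.Fin.Base using (Fin; zero; suc; toℕ; punchIn; splitAt)
open import Data.Integer.Base as ℤ using (ℤ; +_; ∣_∣)
open import Data.Integer.Divisibility using (_∣_)
open import Data.List.Base using (List; []; _∷_; foldr)
open import Data.List.Membership.Propositional using (_∉_)
open import Data.Nat.Base as ℕ using (ℕ; zero; suc; _<_; _∸_; _≤ᵇ_)
open import Data.Nat.Coprimality as ℕ-Coprime using (1-coprimeTo)
open import Data.Nat.Primality using (Prime)
open import Data.Bool.Base using (if_then_else_)
open import Data.Product.Base using (_×_; ∃-syntax)
open import Data.Rational.Base as ℚ using (ℚ; mkℚ; 0ℚ)
open import Data.Sum.Base using ([_,_]′)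
open import Level using (Level; 0ℓ)
open import Relation.Binary.PropositionalEquality.Core using (_≡_; _≢_)
open import Relation.Nullary.Negation.Core using (¬_)
open import Relation.Unary using (Pred; _∈_)

module Polynomial {c ℓ : Level} (R : RawRing c ℓ) where

  open RawRing R
  open RawMonoidDefs +-rawMonoid using (sum) renaming (_×_ to _·_)
  open RawSemiringDefs rawSemiring using (_^_)

  -- Coefficients listed from the constant term upwards; trailing zeros
  -- are allowed.
  Poly : Set c
  Poly = List Carrier

  coeff : Poly → ℕ → Carrier
  coeff []      _       = 0#
  coeff (a ∷ _) zero    = a
  coeff (_ ∷ f) (suc k) = coeff f k

  HasDegree : Poly → ℕ → Set ℓ
  HasDegree f n = ¬ (coeff f n ≈ 0#) × (∀ k → n < k → coeff f k ≈ 0#)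

  -- Laplace expansion along the first row.
  det : ∀ {n} → (Fin n → Fin n → Carrier) → Carrier
  det {zero}  M = 1#
  det {suc n} M = sum λ j →
    ((- 1#) ^ toℕ j) * (M zero j * det λ r s → M (suc r) (punchIn j s))

  -- Row i of a block of shifted coefficient rows b m, …, b 0 (leading
  -- coefficient first), with the top left entry of the block replaced by t.
  shiftedRow : Carrier → (m : ℕ) → (ℕ → Carrier) → (i j : ℕ) → Carrier
  shiftedRow t m b zero zero = t
  shiftedRow t m b i    j    = band i j
    where
    band : ℕ → ℕ → Carrier
    band zero    j       = if j ≤ᵇ m then b (m ∸ j) else 0#
    band (suc _) zero    = 0#
    band (suc i) (suc j) = band i j

  -- The Sylvester matrix of f (in formal degree N = suc n) and f′ (in formal
  -- degree n): n shifted rows of f, then N shifted rows of f′.  The first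
  -- column is divided by the leading coefficient a of f: its only entries that
  -- need not vanish are a and N · a, at the top of each block, which become 1
  -- and N · 1.
  sylvester/lead : (n : ℕ) → Poly → Fin (n ℕ.+ suc n) → Fin (n ℕ.+ suc n) → Carrier
  sylvester/lead n f r s =
    [ (λ i → shiftedRow 1# (suc n) (coeff f) (toℕ i) (toℕ s))
    , (λ i → shiftedRow (suc n · 1#) n f′ (toℕ i) (toℕ s))
    ]′ (splitAt n r)
    where
    f′ : ℕ → Carrier
    f′ k = suc k · coeff f (suc k)

  triangular : ℕ → ℕ
  triangular zero    = zero
  triangular (suc n) = suc n ℕ.+ triangular n

  -- The discriminant (-1)^(N(N-1)/2) · a⁻¹ · Res(f, f′) of a polynomial f of
  -- degree N = suc n with leading coefficient a.
  disc : (n : ℕ) → Poly → Carrier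
  disc n f = ((- 1#) ^ triangular n) * det (sylvester/lead n f)

open Polynomial using (HasDegree; disc)

ℤ[x] : Set
ℤ[x] = Polynomial.Poly ℤ.+-*-rawRing

infix 4 _≡_[mod_]

_≡_[mod_] : ℤ → ℤ → ℕ → Set
a ≡ b [mod p ] = + p ∣ a ℤ.- b

-- ℤ/pℤ as a setoid: the carrier is ℤ and equality is congruence mod p.
𝔽 : ℕ → RawRing 0ℓ 0ℓ
𝔽 p = record
  { Carrier = ℤ
  ; _≈_     = λ a b → a ≡ b [mod p ]
  ; _+_     = ℤ._+_
  ; _*_     = ℤ._*_
  ; -_      = ℤ.-_
  ; 0#      = ℤ.0ℤ
  ; 1#      = ℤ.1ℤ
  }

-- Reducing a coefficient mod p leaves its representative unchanged, and only
-- the equality changes.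
reduce : (p : ℕ) → ℤ[x] → Polynomial.Poly (𝔽 p)
reduce p f = f

record Good (p : ℕ) (f : ℤ[x]) : Set where
  field
    prime        : Prime p
    odd          : p ≢ 2
    n            : ℕ
    degree       : HasDegree ℤ.+-*-rawRing f (suc n)
    degree-mod-p : HasDegree (𝔽 p) (reduce p f) (suc n)
    disc≉0       : ¬ (disc (𝔽 p) n (reduce p f) ≡ ℤ.0ℤ [mod p ])

record Squarefree (d : ℤ) : Set where
  field
    {{nonZero}}    : ℤ.NonZero d
    square-divisor : ∀ k → k ℤ.* k ∣ d → ∣ k ∣ ≡ 1

fromℤ : ℤ → ℚ
fromℤ i = mkℚ i 0 (ℕ-Coprime.sym (1-coprimeTo ∣ i ∣))

eval : ℤ[x] → ℚ → ℚ
eval f r = foldr (λ a v → fromℤ a ℚ.+ r ℚ.* v) 0ℚ f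

-- S(r) = d, as a relation.
record IsSquarefreePart (r : ℚ) (d : ℤ) : Set where
  field
    squarefree : Squarefree d
  open Squarefree squarefree public
  field
    square     : ∃[ q ] (r ℚ.÷ fromℤ d) ≡ q ℚ.* q

𝒮 : ℤ[x] → Pred ℤ 0ℓ
𝒮 f d = ∃[ r ] (eval f r ≢ 0ℚ × IsSquarefreePart (eval f r) d)

-- No finite list exhausts P.
Infinite : Pred ℤ 0ℓ → Set
Infinite P = (xs : List ℤ) → ∃[ d ] (d ∈ P × d ∉ xs)

{-# OPTIONS --safe #-}

-- A polynomial of degree 1 is surjective on ℚ, so 𝒮(f) is the set of all
-- squarefree integers, and one needs squarefree numbers in the progression
-- a + p k with gcd (a, p) = 1 and a arbitrarily large.  For j ≥ 2 at most
-- 1 + N / j² of the first N terms are divisible by j², since two such terms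
-- have indices differing by a multiple of j².  As 1/j² ≤ 1/(j - ½) - 1/(j + ½),
-- the sum of 1/j² over j ≥ 2 is at most 2/3; hence at most 2N/3 + M terms are
-- divisible by one of the squares of 2, …, M + 1.  For N = 3M + 1 this leaves a
-- term that is divisible by none of them, and for M = a + 3p all larger
-- squares exceed it.

module Submission where

open import Defs
open import Data.Bool.Base using (if_then_else_)
open import Data.Empty using (⊥; ⊥-elim)
open import Data.Integer.Base as ℤ using (ℤ; +_; +-*-rawRing; ∣_∣)
open import Data.Integer.Coprimality using (Coprime)
open import Data.Integer.DivMod using (_%ℕ_; _/ℕ_; a≡a%ℕn+[a/ℕn]*n)
import Data.Integer.Divisibility as ℤ∣
import Data.Integer.Divisibility.Signed as Signed
import Data.Integer.Properties as ℤ
import Data.Integer.Tactic.RingSolver as ℤ-Solver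
open import Data.List.Base using (List; []; _∷_; map)
open import Data.List.Membership.Propositional using () renaming (_∈_ to _∈ˡ_)
open import Data.List.Membership.Propositional.Properties using (∈-map⁺)
open import Data.List.Relation.Unary.Any using (here; there)
open import Data.Nat.Base using (ℕ; zero; suc; pred; _+_; _*_; _∸_; _≤_; _<_; z≤n; s≤s; NonZero; >-nonZero; >-nonZero⁻¹)
import Data.Nat.Base as ℕ
import Data.Nat.Coprimality as ℕ
open import Data.Nat.Divisibility using (_∣_; _∤_; _∣?_; ∣-trans; ∣m+n∣m⇒∣n; m∣m*n; ∣⇒≤; 0∣⇒≡0)
open import Data.Nat.ListAction using (sum)
open import Data.Nat.Primality using (prime⇒nonZero)
open import Data.Nat.Properties
open import Algebra.Properties.CommutativeSemigroup +-commutativeSemigroup using (interchange)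
open import Data.Nat.Tactic.RingSolver using (solve-∀)
open import Data.Product.Base using (_×_; _,_; ∃-syntax; proj₁; proj₂)
open import Data.Rational.Base as ℚ using (ℚ; 0ℚ; 1ℚ)
import Data.Rational.Properties as ℚ
open import Data.Sum.Base using (_⊎_; inj₁; inj₂; [_,_]′)
open import Relation.Binary.PropositionalEquality
open import Relation.Nullary using (yes; no; does)
open import Relation.Unary using (_∈_)

-- Finite sums over initial segments.

sum< : ℕ → (ℕ → ℕ) → ℕ
sum< zero    f = 0
sum< (suc n) f = sum< n f + f n

sum<-zero : ∀ n → sum< n (λ _ → 0) ≡ 0
sum<-zero zero    = refl
sum<-zero (suc n) = trans (+-identityʳ _) (sum<-zero n)

sum<-+ : ∀ n f g → sum< n (λ i → f i + g i) ≡ sum< n f + sum< n g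
sum<-+ zero    f g = refl
sum<-+ (suc n) f g =
  trans (cong (_+ (f n + g n)) (sum<-+ n f g)) (interchange (sum< n f) (sum< n g) (f n) (g n))

sum<-swap : ∀ m n (f : ℕ → ℕ → ℕ) →
  sum< m (λ i → sum< n (f i)) ≡ sum< n (λ j → sum< m (λ i → f i j))
sum<-swap zero    n f = sym (sum<-zero n)
sum<-swap (suc m) n f =
  trans (cong (_+ sum< n (f m)) (sum<-swap m n f)) (sym (sum<-+ n _ (f m)))

sum<≡0⇒≡0 : ∀ n f → sum< n f ≡ 0 → ∀ {i} → i < n → f i ≡ 0
sum<≡0⇒≡0 (suc n) f eq {i} (s≤s i≤n) with m≤n⇒m<n∨m≡n i≤n
... | inj₁ i<n  = sum<≡0⇒≡0 n f (m+n≡0⇒m≡0 _ eq) i<n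
... | inj₂ refl = m+n≡0⇒n≡0 (sum< n f) eq

-- Pigeonhole: `n` positive summands would add up to at least `n`. A positive last summand uses up
-- at least one unit, so the strict bound survives its removal.
sum<-small⇒∃≡0 : ∀ n f → sum< n f < n → ∃[ i ] (i < n × f i ≡ 0)
sum<-small⇒∃≡0 (suc n) f (s≤s le) with f n in eq
... | zero  = n , ≤-refl , eq
... | suc y with sum<-small⇒∃≡0 n f (<-≤-trans (m<m+n _ (s≤s z≤n)) le)
...   | i , i<n , fi≡0 = i , m<n⇒m<1+n i<n , fi≡0

-- Multiples of a fixed number in an arithmetic progression.

divisible : ℕ → ℕ → ℕ
divisible D x = if does (D ∣? x) then 1 else 0

divisible≡0⇒∤ : ∀ D x → divisible D x ≡ 0 → D ∤ x
divisible≡0⇒∤ D x eq with D ∣? x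
... | no D∤x = D∤x

module Progression (a p : ℕ) (a⊥p : ℕ.Coprime a p) where

  term : ℕ → ℕ
  term k = a + p * k

  ∣term⇒coprime : ∀ {D} k → D ∣ term k → ℕ.Coprime D p
  ∣term⇒coprime k D∣t {i} (i∣D , i∣p) =
    a⊥p (∣m+n∣m⇒∣n (subst (i ∣_) (+-comm a (p * k)) (∣-trans i∣D D∣t)) (∣-trans i∣p (m∣m*n k)) , i∣p)

  -- `D` divides the difference `p * (k ∸ l)` of the two terms and is coprime to `p`, so it divides
  -- the positive number `k ∸ l`.
  ∣terms⇒≤ : ∀ {D k l} → l < k → D ∣ term l → D ∣ term k → l + D ≤ k
  ∣terms⇒≤ {D} {k} {l} l<k D∣l D∣k = begin
    l + D       ≤⟨ +-monoʳ-≤ l (∣⇒≤ {{>-nonZero (m<n⇒0<n∸m l<k)}} D∣k∸l) ⟩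
    l + (k ∸ l) ≡⟨ m+[n∸m]≡n (<⇒≤ l<k) ⟩
    k           ∎
    where
    open ≤-Reasoning
    term-split : term k ≡ term l + p * (k ∸ l)
    term-split = trans (cong term (sym (m+[n∸m]≡n (<⇒≤ l<k))))
      (trans (cong (λ x → a + x) (*-distribˡ-+ p l (k ∸ l))) (sym (+-assoc a (p * l) (p * (k ∸ l)))))
    D∣k∸l : D ∣ k ∸ l
    D∣k∸l = ℕ.coprime-divisor (∣term⇒coprime l D∣l) (∣m+n∣m⇒∣n (subst (D ∣_) term-split D∣k) D∣l)

  count : ℕ → ℕ → ℕ
  count N D = sum< N (λ k → divisible D (term k))

  -- The witness l is the last index below N whose term is divisible by D.
  count-spread : ∀ N D →
    count N D ≡ 0 ⊎ ∃[ l ] (l < N × D ∣ term l × ∃[ c ] (count N D ≡ suc c × D * c ≤ l))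
  count-spread zero    D = inj₁ refl
  count-spread (suc N) D with D ∣? term N | count-spread N D
  ... | no _  | inj₁ eq = inj₁ (trans (+-identityʳ _) eq)
  ... | no _  | inj₂ (l , l<N , D∣l , c , eq , le) =
    inj₂ (l , m<n⇒m<1+n l<N , D∣l , c , trans (+-identityʳ _) eq , le)
  ... | yes D∣N | inj₁ eq =
    inj₂ (N , ≤-refl , D∣N , 0 , cong (_+ 1) eq , ≤-trans (≤-reflexive (*-zeroʳ D)) z≤n)
  -- The new hit `N` lies at least `D` beyond the previous hit `l`, which pays for raising `c` by
  -- one.
  ... | yes D∣N | inj₂ (l , l<N , D∣l , c , eq , le) =
    inj₂ (N , ≤-refl , D∣N , suc c , trans (cong (_+ 1) eq) (+-comm (suc c) 1) , (begin
      D * suc c ≡⟨ *-suc D c ⟩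
      D + D * c ≤⟨ +-monoʳ-≤ D le ⟩
      D + l     ≡⟨ +-comm D l ⟩
      l + D     ≤⟨ ∣terms⇒≤ l<N D∣l D∣N ⟩
      N         ∎))
    where open ≤-Reasoning

  -- The first hit may occur at any index, so `pred` leaves it out; each further hit costs `D`
  -- indices. Since `pred 0` is `0`, this also covers the case of no hit.
  count-bound : ∀ N D → D * pred (count N D) ≤ N
  count-bound N D with count-spread N D
  ... | inj₁ eq rewrite eq | *-zeroʳ D = z≤n
  ... | inj₂ (l , l<N , _ , c , eq , le) rewrite eq = ≤-trans le (<⇒≤ l<N)

-- Summing the counts over the squares.

sum<-pred : ∀ n f → sum< n f ≤ sum< n (λ i → pred (f i)) + n
sum<-pred zero    f = z≤n
sum<-pred (suc n) f = begin
  sum< n f + f n                 ≤⟨ +-mono-≤ (sum<-pred n f) (≤suc-pred (f n)) ⟩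
  (s + n) + (1 + pred (f n))     ≡⟨ rearrange s n (pred (f n)) ⟩
  (s + pred (f n)) + suc n       ∎
  where
  open ≤-Reasoning
  s = sum< n (λ i → pred (f i))
  ≤suc-pred : ∀ x → x ≤ 1 + pred x
  ≤suc-pred zero    = z≤n
  ≤suc-pred (suc x) = ≤-refl
  rearrange : ∀ s n x → (s + n) + (1 + x) ≡ (s + x) + suc n
  rearrange = solve-∀

-- The telescoping bound Σ_{2 ≤ j ≤ M+1} 1/j² ≤ 2/3 - 2/(2M+3), cleared of
-- denominators.
telescope : ∀ N (e : ℕ → ℕ) → (∀ i → (2 + i) * (2 + i) * e i ≤ N) →
  ∀ M → 3 * (3 + 2 * M) * sum< M e ≤ 4 * M * N
telescope N e bound zero    = z≤n
telescope N e bound (suc M) = *-cancelˡ-≤ (3 + 2 * M) (begin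
  (3 + 2 * M) * (3 * (3 + 2 * suc M) * (sum< M e + e M))
    ≡⟨ split M (sum< M e) (e M) ⟩
  (5 + 2 * M) * (3 * (3 + 2 * M) * sum< M e) + 3 * ((3 + 2 * M) * (5 + 2 * M) * e M)
    ≤⟨ +-mono-≤ (*-monoʳ-≤ (5 + 2 * M) (telescope N e bound M)) (*-monoʳ-≤ 3 last-term) ⟩
  (5 + 2 * M) * (4 * M * N) + 3 * (4 * N)
    ≡⟨ collect M N ⟩
  (3 + 2 * M) * (4 * suc M * N) ∎)
  where
  open ≤-Reasoning
  split : ∀ M s x → (3 + 2 * M) * (3 * (3 + 2 * suc M) * (s + x))
    ≡ (5 + 2 * M) * (3 * (3 + 2 * M) * s) + 3 * ((3 + 2 * M) * (5 + 2 * M) * x)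
  split = solve-∀
  collect : ∀ M N → (5 + 2 * M) * (4 * M * N) + 3 * (4 * N) ≡ (3 + 2 * M) * (4 * suc M * N)
  collect = solve-∀
  -- This is `(j - ½)(j + ½) = j² - ¼` for `j = 2 + M`, multiplied by 4; it is the source of the
  -- bound on `1/j²`.
  square : ∀ M x → (3 + 2 * M) * (5 + 2 * M) * x + x ≡ 4 * ((2 + M) * (2 + M) * x)
  square = solve-∀
  last-term : (3 + 2 * M) * (5 + 2 * M) * e M ≤ 4 * N
  last-term = begin
    (3 + 2 * M) * (5 + 2 * M) * e M       ≤⟨ m≤m+n _ (e M) ⟩
    (3 + 2 * M) * (5 + 2 * M) * e M + e M ≡⟨ square M (e M) ⟩
    4 * ((2 + M) * (2 + M) * e M)         ≤⟨ *-monoʳ-≤ 4 (bound M) ⟩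
    4 * N                                 ∎

-- Dropping the term `2/(2M+3)` makes the bound uniform in `M`: adding `6 * N` completes `4 * M` to
-- `2 * (3 + 2 * M)`.
3*sum≤2*N : ∀ N (e : ℕ → ℕ) → (∀ i → (2 + i) * (2 + i) * e i ≤ N) →
  ∀ M → 3 * sum< M e ≤ 2 * N
3*sum≤2*N N e bound M = *-cancelˡ-≤ (3 + 2 * M) (begin
  (3 + 2 * M) * (3 * sum< M e)  ≡⟨ left M (sum< M e) ⟩
  3 * (3 + 2 * M) * sum< M e    ≤⟨ telescope N e bound M ⟩
  4 * M * N                     ≤⟨ m≤m+n _ (6 * N) ⟩
  4 * M * N + 6 * N             ≡⟨ right M N ⟩
  (3 + 2 * M) * (2 * N)         ∎)
  where
  open ≤-Reasoning
  left : ∀ M s → (3 + 2 * M) * (3 * s) ≡ 3 * (3 + 2 * M) * s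
  left = solve-∀
  right : ∀ M N → 4 * M * N + 6 * N ≡ (3 + 2 * M) * (2 * N)
  right = solve-∀

-- The sieve by squares.

∃squarefree-term : ∀ a p → ℕ.Coprime a p → NonZero a →
  ∃[ k ] (∀ j → j * j ∣ a + p * k → j ≡ 1)
∃squarefree-term a p a⊥p a≢0 =
  let k , k<N , eq = sum<-small⇒∃≡0 N _ total in k , unsieved⇒squarefree k k<N eq
  where
  open Progression a p a⊥p
  open ≤-Reasoning
  -- `M` is large enough for `(2 + M)²` to exceed the first `N` terms, and `N` is the least number
  -- with `2 * N + 3 * M < 3 * N`.
  M = a + 3 * p
  N = 1 + 3 * M
  sq : ℕ → ℕ
  sq i = (2 + i) * (2 + i)
  excess : ℕ → ℕ
  excess i = pred (count N (sq i))

  total : sum< N (λ k → sum< M (λ i → divisible (sq i) (term k))) < N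
  total = *-cancelˡ-< 3 _ _ (begin-strict
    3 * sum< N (λ k → sum< M (λ i → divisible (sq i) (term k)))
      ≡⟨ cong (3 *_) (sum<-swap N M (λ k i → divisible (sq i) (term k))) ⟩
    3 * sum< M (λ i → count N (sq i))
      -- One first hit is split off for each of the `M` squares, as `count-bound` controls only the
      -- others.
      ≤⟨ *-monoʳ-≤ 3 (sum<-pred M (λ i → count N (sq i))) ⟩
    3 * (sum< M excess + M)
      ≡⟨ *-distribˡ-+ 3 (sum< M excess) M ⟩
    3 * sum< M excess + 3 * M
      ≤⟨ +-monoˡ-≤ (3 * M) (3*sum≤2*N N excess (λ i → count-bound N (sq i)) M) ⟩
    2 * N + 3 * M
      <⟨ ≤-refl ⟩
    1 + (2 * N + 3 * M)
      ≡⟨ finish M ⟩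
    3 * N ∎)
    where
    finish : ∀ M → 1 + (2 * (1 + 3 * M) + 3 * M) ≡ 3 * (1 + 3 * M)
    finish = solve-∀

  term<square : ∀ {k i} → k < N → M ≤ i → term k < sq i
  term<square {k} {i} k<N M≤i = begin-strict
    a + p * k                                      ≤⟨ +-monoʳ-≤ a (*-monoʳ-≤ p (<⇒≤ k<N)) ⟩
    -- The added expression is `(2 + M)² - 1 - (a + p * N)`; it has no negative part because the
    -- `3 * p` in `M` lets `M²` absorb the `3 * p * M` in `p * N`.
    a + p * N                                      ≤⟨ m≤m+n _ (a * M + 3 * a + 11 * p + 3) ⟩
    a + p * N + (a * M + 3 * a + 11 * p + 3)       <⟨ ≤-refl ⟩
    1 + (a + p * N + (a * M + 3 * a + 11 * p + 3)) ≡⟨ expand a p ⟩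
    (2 + M) * (2 + M)                              ≤⟨ *-mono-≤ (+-monoʳ-≤ 2 M≤i) (+-monoʳ-≤ 2 M≤i) ⟩
    sq i                                           ∎
    where
    expand : ∀ a p → 1 + (a + p * (1 + 3 * (a + 3 * p)) + (a * (a + 3 * p) + 3 * a + 11 * p + 3))
      ≡ (2 + (a + 3 * p)) * (2 + (a + 3 * p))
    expand = solve-∀

  instance
    term≢0 : ∀ {k} → NonZero (term k)
    term≢0 {k} = >-nonZero (≤-trans (>-nonZero⁻¹ a {{a≢0}}) (m≤m+n a (p * k)))

  unsieved⇒squarefree : ∀ k → k < N → sum< M (λ i → divisible (sq i) (term k)) ≡ 0 →
    ∀ j → j * j ∣ term k → j ≡ 1
  unsieved⇒squarefree k k<N eq zero          0∣t = ⊥-elim (ℕ.≢-nonZero⁻¹ (term k) (0∣⇒≡0 0∣t))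
  unsieved⇒squarefree k k<N eq (suc zero)    _   = refl
  -- Here `j = 2 + i`: for `i < M` its square was sieved out, otherwise its square exceeds the term.
  unsieved⇒squarefree k k<N eq (suc (suc i)) s∣t = ⊥-elim ([ small , large ]′ (<-≤-connex i M))
    where
    small : i < M → ⊥
    small i<M = divisible≡0⇒∤ (sq i) (term k)
      (sum<≡0⇒≡0 M (λ i → divisible (sq i) (term k)) eq i<M) s∣t
    large : M ≤ i → ⊥
    large M≤i = <⇒≱ (term<square k<N M≤i) (∣⇒≤ s∣t)

-- Squarefree integers in a residue class.

∈⇒≤sum : ∀ {x} {xs : List ℕ} → x ∈ˡ xs → x ≤ sum xs
∈⇒≤sum (here refl)        = m≤m+n _ _
∈⇒≤sum {xs = y ∷ _} (there x∈xs) = ≤-trans (∈⇒≤sum x∈xs) (m≤n+m _ y)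

squarefrees-infinite : ∀ p .{{_ : NonZero p}} m → Coprime m (+ p) →
  Infinite (λ d → Squarefree d × d ≡ m [mod p ])
squarefrees-infinite p m m⊥p xs = + n , (squarefree , n≡m) , n∉xs
  where
  B r a : ℕ
  -- `B` bounds every absolute value in `xs`. As `p` is positive, the shift by `p * suc B` moves the
  -- start `a` of the progression strictly beyond `B` without leaving the class of `m`.
  B = sum (map ∣_∣ xs)
  r = m %ℕ p
  a = r + p * suc B
  z : ℤ
  z = m /ℕ p

  B<a : B < a
  B<a = ≤-trans (m≤n*m (suc B) p) (m≤n+m _ r)

  -- A common divisor of `a` and `p` divides `r`, hence also `m = r + z * p`.
  a⊥p : ℕ.Coprime a p
  a⊥p {i} (i∣a , i∣p) = m⊥p (i∣m , i∣p)
    where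
    i∣r : i ∣ r
    i∣r = ∣m+n∣m⇒∣n (subst (i ∣_) (+-comm r _) i∣a) (∣-trans i∣p (m∣m*n (suc B)))
    i∣m : i ∣ ∣ m ∣
    i∣m = subst (+ i ℤ∣.∣_) (sym (a≡a%ℕn+[a/ℕn]*n m p))
      (Signed.∣⇒∣ᵤ (Signed.∣m∣n⇒∣m+n (Signed.∣ᵤ⇒∣ {+ i} {+ r} i∣r)
                                       (Signed.∣n⇒∣m*n z (Signed.∣ᵤ⇒∣ {+ i} {+ p} i∣p))))

  found = ∃squarefree-term a p a⊥p (>-nonZero (≤-trans (s≤s z≤n) B<a))
  k = proj₁ found
  n = a + p * k

  a≤n : a ≤ n
  a≤n = m≤m+n a (p * k)

  squarefree : Squarefree (+ n)
  squarefree = record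
    { nonZero        = >-nonZero (≤-trans (s≤s z≤n) (≤-trans B<a a≤n))
    ; square-divisor = λ j j²∣n → proj₂ found ∣ j ∣ (subst (_∣ n) (ℤ.abs-* j j) j²∣n)
    }

  n≡m : + n ≡ m [mod p ]
  n≡m = Signed.∣⇒∣ᵤ (Signed.divides (+ suc B ℤ.+ + k ℤ.- z) (begin
    + n ℤ.- m
      ≡⟨ cong₂ ℤ._-_ n-expand (a≡a%ℕn+[a/ℕn]*n m p) ⟩
    (+ r ℤ.+ + p ℤ.* + suc B ℤ.+ + p ℤ.* + k) ℤ.- (+ r ℤ.+ z ℤ.* + p)
      ≡⟨ cancel (+ r) (+ p) (+ suc B) (+ k) z ⟩
    (+ suc B ℤ.+ + k ℤ.- z) ℤ.* + p ∎))
    where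
    open ≡-Reasoning
    n-expand : + n ≡ + r ℤ.+ + p ℤ.* + suc B ℤ.+ + p ℤ.* + k
    n-expand = cong₂ ℤ._+_ (cong (λ x → + r ℤ.+ x) (ℤ.pos-* p (suc B))) (ℤ.pos-* p k)
    cancel : ∀ r p b k z →
      (r ℤ.+ p ℤ.* b ℤ.+ p ℤ.* k) ℤ.- (r ℤ.+ z ℤ.* p) ≡ (b ℤ.+ k ℤ.- z) ℤ.* p
    cancel = ℤ-Solver.solve-∀

  n∉xs : + n ∈ˡ xs → _
  n∉xs n∈xs = <⇒≱ (<-≤-trans B<a a≤n) (∈⇒≤sum (∈-map⁺ ∣_∣ n∈xs))

-- Values of linear polynomials.

open Polynomial +-*-rawRing using (coeff; HasDegree)

-- Coefficient lists may have trailing zeros; this discards what follows the first two entries of a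
-- linear polynomial.
eval-zero : ∀ f → (∀ k → coeff f k ≡ ℤ.0ℤ) → ∀ r → eval f r ≡ 0ℚ
eval-zero []      _     r = refl
eval-zero (c ∷ f) zeros r = begin
  fromℤ c ℚ.+ r ℚ.* eval f r
    ≡⟨ cong₂ (λ c v → fromℤ c ℚ.+ r ℚ.* v) (zeros 0) (eval-zero f (λ k → zeros (suc k)) r) ⟩
  0ℚ ℚ.+ r ℚ.* 0ℚ ≡⟨ ℚ.+-identityˡ _ ⟩
  r ℚ.* 0ℚ        ≡⟨ ℚ.*-zeroʳ r ⟩
  0ℚ              ∎
  where open ≡-Reasoning

linear-surjective : ∀ f → HasDegree f 1 → ∀ y → ∃[ r ] eval f r ≡ y
linear-surjective []          (a≢0 , _)     y = ⊥-elim (a≢0 refl)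
linear-surjective (b ∷ [])    (a≢0 , _)     y = ⊥-elim (a≢0 refl)
linear-surjective (b ∷ a ∷ f) (a≢0 , zeros) y = r , (begin
  fromℤ b ℚ.+ r ℚ.* (fromℤ a ℚ.+ r ℚ.* eval f r)
    ≡⟨ cong (λ v → fromℤ b ℚ.+ r ℚ.* (fromℤ a ℚ.+ r ℚ.* v))
            (eval-zero f (λ k → zeros (suc (suc k)) (s≤s (s≤s z≤n))) r) ⟩
  fromℤ b ℚ.+ r ℚ.* (fromℤ a ℚ.+ r ℚ.* 0ℚ)
    ≡⟨ cong (λ v → fromℤ b ℚ.+ r ℚ.* v)
            (trans (cong (fromℤ a ℚ.+_) (ℚ.*-zeroʳ r)) (ℚ.+-identityʳ _)) ⟩
  fromℤ b ℚ.+ r ℚ.* fromℤ a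
    ≡⟨ cong (fromℤ b ℚ.+_) ra≡y-b ⟩
  fromℤ b ℚ.+ (y ℚ.- fromℤ b)
    ≡⟨ ℚ.+-comm (fromℤ b) (y ℚ.- fromℤ b) ⟩
  y ℚ.- fromℤ b ℚ.+ fromℤ b
    ≡⟨ ℚ.+-assoc y _ _ ⟩
  y ℚ.+ (ℚ.- fromℤ b ℚ.+ fromℤ b)
    ≡⟨ cong (y ℚ.+_) (ℚ.+-inverseˡ (fromℤ b)) ⟩
  y ℚ.+ 0ℚ
    ≡⟨ ℚ.+-identityʳ y ⟩
  y ∎)
  where
  open ≡-Reasoning
  instance
    a-nonZero : ℤ.NonZero a
    a-nonZero = ℤ.≢-nonZero a≢0
  r : ℚ
  r = (y ℚ.- fromℤ b) ℚ.÷ fromℤ a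
  ra≡y-b : r ℚ.* fromℤ a ≡ y ℚ.- fromℤ b
  ra≡y-b = trans (ℚ.*-assoc (y ℚ.- fromℤ b) _ _)
    (trans (cong ((y ℚ.- fromℤ b) ℚ.*_) (ℚ.*-inverseˡ (fromℤ a))) (ℚ.*-identityʳ _))

-- At a rational `r` with `f(r) = d` the quotient `f(r)/d` is `1`, the square of `1`.
linear⇒squarefree∈𝒮 : ∀ f → HasDegree f 1 → ∀ {d} → Squarefree d → d ∈ 𝒮 f
linear⇒squarefree∈𝒮 f deg {d} sf with linear-surjective f deg (fromℤ d)
... | r , fr≡d = r , fr≢0 , record { squarefree = sf ; square = 1ℚ , fr/d≡1 }
  where
  open Squarefree sf
  fr≢0 : eval f r ≢ 0ℚ
  -- The numerator of `fromℤ d` is `d` itself, which is nonzero.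
  fr≢0 fr≡0 = ℕ.≢-nonZero⁻¹ ∣ d ∣ (cong (λ q → ∣ ℚ.↥ q ∣) (trans (sym fr≡d) fr≡0))
  fr/d≡1 : eval f r ℚ.÷ fromℤ d ≡ 1ℚ ℚ.* 1ℚ
  fr/d≡1 = trans (cong (ℚ._÷ fromℤ d) fr≡d) (ℚ.*-inverseʳ (fromℤ d))

proposition3p4 : (f : ℤ[x]) → Polynomial.HasDegree +-*-rawRing f 1 →
    (p : ℕ) → Good p f →
    (m : ℤ) → Coprime m (+ p) →
    Infinite (λ d → d ∈ 𝒮 f × d ≡ m [mod p ])
proposition3p4 f deg p good m m⊥p xs =
  let d , (sf , d≡m) , d∉xs = squarefrees-infinite p {{prime⇒nonZero (Good.prime good)}} m m⊥p xs
  in  d , (linear⇒squarefree∈𝒮 f deg sf , d≡m) , d∉xs
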